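{- There exists a complete bifurcate tree over an alphabet of size $12$.
   Context: A square is a nonempty word of the form $XX$; a word is square-free if it has no (contiguous) factor that is a square. For a word $W$ of length $n$ and $0\le i\le n$, let $P_i(W)$, $S_i(W)$ be the prefix and suffix of $W$ of length $i$; an extension of $W$ at position $i$ over alphabet $\mathcal{A}$ is a word $P_i(W)\mathtt{x}S_{n-i}(W)$ with $\mathtt{x}\in\mathcal{A}$. A square-free word of length $n$ is bifurcate over $\mathcal{A}$ if for each position $i\in\{0,\dots,n\}$ it has a square-free extension at position $i$. A bifurcate tree over $\mathcal{A}$ is a family of bifurcate words over $\mathcal{A}$ arranged as a rooted tree in which the children (descendants) of a word $W$ are single-letter extensions of $W$ at pairwise different positions; thus a word of length $n$ has at most $n+1$ children. A bifurcate tree is complete if every word of length $n$ in it has exactly $n+1$ children (one extension at each position $0,\dots,n$); such a tree is necessarily infinite. -}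

module Defs where

open import Data.Nat.Base using (suc)
open import Data.Fin.Base using (Fin; toℕ)
open import Data.List.Base using (List; []; _∷_; _++_; length; take; drop)
open import Data.List.Relation.Binary.Infix.Heterogeneous using (Infix)
open import Data.Product.Base using (Σ; ∃; _×_; _,_)
open import Function.Definitions using (Injective; Bijective)
open import Relation.Binary.Construct.Closure.ReflexiveTransitive using (Star)
open import Relation.Binary.PropositionalEquality.Core using (_≡_; _≢_)
open import Relation.Nullary.Negation.Core using (¬_)

Word : Set → Set
Word A = List A

Square : {A : Set} → Word A → Set
Square S = ∃ λ X → X ≢ [] × S ≡ X ++ X

SquareFree : {A : Set} → Word A → Set
SquareFree W = ∀ F → Infix _≡_ F W → ¬ Square F

-- The positions 0, …, n of a word of length n.
Position : {A : Set} → Word A → Set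
Position W = Fin (suc (length W))

-- P_i(W) x S_{n-i}(W): the suffix of length n - i is what remains of W after
-- its first i letters.
extend : {A : Set} (W : Word A) → Position W → A → Word A
extend W i x = take (toℕ i) W ++ x ∷ drop (toℕ i) W

Bifurcate : {A : Set} → Word A → Set
Bifurcate W = SquareFree W × (∀ i → ∃ λ x → SquareFree (extend W i x))

-- Child v indexes the children of v.  By child-injective and root-not-child, a
-- node is the child of at most one node, under one index only, and the root is
-- the child of none; with reachable this gives a unique path from the root to
-- each node.
record RootedTree : Set₁ where
  field
    Node            : Set
    root            : Node
    Child           : Node → Set
    child           : (v : Node) → Child v → Node
    child-injective : ∀ {v w} (c : Child v) (d : Child w) →
                      child v c ≡ child w d → _≡_ {A = Σ Node Child} (v , c) (w , d)
    root-not-child  : ∀ v (c : Child v) → child v c ≢ root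

  _⟶_ : Node → Node → Set
  v ⟶ w = ∃ λ c → child v c ≡ w

  field
    reachable : ∀ v → Star _⟶_ root v

-- Nodes carry words, and different nodes may carry the same word: extending at
-- two positions in either order can give the same result.  (In a complete tree
-- this is unavoidable over a finite alphabet, since the numbers of nodes on
-- successive levels grow factorially.)
record BifurcateTree (A : Set) : Set₁ where
  field
    tree : RootedTree
  open RootedTree tree public
  field
    word               : Node → Word A
    bifurcate          : ∀ v → Bifurcate (word v)
    position           : ∀ v → Child v → Position (word v)
    position-injective : ∀ v → Injective _≡_ _≡_ (position v)
    child-extends      : ∀ v (c : Child v) → ∃ λ x →
                         word (child v c) ≡ extend (word v) (position v c) x

-- Bijectivity of the position map says that a node with a word of length n has
-- exactly n + 1 children, one at each position 0, …, n.
Complete : {A : Set} → BifurcateTree A → Set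
Complete T = ∀ v → Bijective _≡_ _≡_ (position v)
  where open BifurcateTree T

{-# OPTIONS --safe #-}

-- Inserting a letter between two neighbours of the current word glues a triangle
-- onto the corresponding edge of an outerplanar triangulation, so the word is read
-- along the outer path.  A vertex gets a level (one more than the lower of its two
-- neighbours, the ends counting as level −1) and an index along the path formed by
-- its level; it is coloured by the pair of a four-letter word at the level and a
-- ternary word at the index.
--
-- Both words are square-free, the ternary one is two-sided (first differences of
-- the Thue–Morse word), and any three consecutive letters of the four-letter word
-- are distinct.  The levels along the outer path change by at most one, and for
-- such a walk the four-letter word makes the levels of the halves of a square
-- agree: the second half is a translate or a reflection of the first, a nonzero
-- translation would produce a square in the four-letter word and a proper
-- reflection two equal letters at distance one or two.  The vertices of lowest
-- level in the square then carry consecutive indices, and their ternary letters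
-- form a square, a contradiction.
module Submission where

open import Defs
open import Data.Bool.Base using (Bool; true; false; not; _xor_)
open import Data.Bool.Properties using (not-injective; not-involutive; not-¬; not-distribʳ-xor) renaming (_≟_ to _≟ᵇ_)
open import Data.Empty using (⊥-elim)
open import Data.Fin.Base using (Fin; zero; suc; toℕ; combine)
open import Data.Fin.Properties using (combine-injective) renaming (suc-injective to Fin-suc-injective)
open import Data.Integer.Base as ℤ using (ℤ; +_; -[1+_])
import Data.Integer.Properties as ℤ
import Data.Integer.Tactic.RingSolver as ℤ-Solver
open import Data.List.Base using (List; []; _∷_; _++_; length; map; mapMaybe; catMaybes; take; drop)
open import Data.List.Membership.Propositional using (_∈_)
open import Data.List.Properties using (∷-injective; map-++; mapMaybe-++; map-mapMaybe; take-map; drop-map; take++drop≡id)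
open import Data.List.Relation.Binary.Infix.Heterogeneous using (MkView; toView)
open import Data.List.Relation.Binary.Pointwise using (Pointwise-≡⇒≡)
open import Data.List.Relation.Unary.All as All using (All; []; _∷_)
open import Data.List.Relation.Unary.All.Properties using (++⁺; map⁻)
open import Data.List.Relation.Unary.Any using (here; there)
open import Data.List.Relation.Unary.Linked using (Linked; []; [-]; _∷_)
open import Data.Maybe.Base as Maybe using (Maybe; just; nothing)
open import Data.Maybe.Properties using (just-injective)
open import Data.Nat.Base using (ℕ; zero; suc; _+_; _∸_; _≤_; _<_; z≤n; s≤s; s≤s⁻¹)
open import Data.Nat.Induction using (<-rec)
open import Data.Nat.Properties using (_≟_; +-suc; +-identityʳ; +-comm; +-assoc; +-cancelʳ-≡; +-cancelˡ-≡; +-mono-≤; +-monoˡ-≤; suc-injective; ≤-refl; ≤-reflexive; ≤-trans; ≤-total; <⇒≤; <-≤-trans; ≤-<-trans; <-irrefl; <-cmp; n≤1+n; m≤n⇒m≤1+n; m≤n+m; m<m+n; m∸n+n≡m; m≤n⇒m<n∨m≡n)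
open import Data.Product.Base using (∃; ∃₂; _×_; _,_; proj₁; proj₂)
open import Data.Sum.Base as Sum using (_⊎_; inj₁; inj₂)
open import Function.Base using (id)
open import Relation.Binary.Construct.Closure.ReflexiveTransitive using (Star; ε; _◅_; _◅◅_)
open import Relation.Binary.Definitions using (tri<; tri≈; tri>)
open import Relation.Binary.PropositionalEquality.Core using (_≡_; _≢_; refl; sym; trans; cong; cong₂; subst)
open import Relation.Nullary.Decidable.Core using (yes; no)
open import Relation.Nullary.Negation.Core using (¬_; contradiction)

-- The two-sided Thue–Morse word

increment : List Bool → List Bool
increment []           = true ∷ []
increment (false ∷ bs) = true ∷ bs
increment (true  ∷ bs) = false ∷ increment bs

-- Least significant bit first.
binary : ℕ → List Bool
binary zero    = []
binary (suc n) = increment (binary n)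

parity : List Bool → Bool
parity []       = false
parity (b ∷ bs) = b xor parity bs

thueMorse : ℕ → Bool
thueMorse n = parity (binary n)

-- Zero has no digits, so doubling it prepends none; hence the successor here and the separate case
-- for zero in the next two lemmas.
binary-double : ∀ n → binary (suc n + suc n) ≡ false ∷ binary (suc n)
binary-double zero    = refl
binary-double (suc n) rewrite +-suc n (suc n) | binary-double n = refl

thueMorse-double : ∀ n → thueMorse (n + n) ≡ thueMorse n
thueMorse-double zero    = refl
thueMorse-double (suc n) rewrite binary-double n = refl

thueMorse-suc-double : ∀ n → thueMorse (suc (n + n)) ≡ not (thueMorse n)
thueMorse-suc-double zero    = refl
thueMorse-suc-double (suc n) rewrite binary-double n = refl

-- Halving exchanges the two ways of continuing the Thue–Morse word to the left.
thueMorseℤ : Bool → ℤ → Bool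
thueMorseℤ b (+ n)    = thueMorse n
thueMorseℤ b -[1+ n ] = b xor thueMorse n

not-xor : ∀ a b → not a xor b ≡ a xor not b
not-xor false b = refl
not-xor true  b = sym (not-involutive b)

thueMorseℤ-double : ∀ b k → thueMorseℤ b (k ℤ.+ k) ≡ thueMorseℤ (not b) k
thueMorseℤ-double b (+ n)    = thueMorse-double n
thueMorseℤ-double b -[1+ n ] =
  trans (cong (b xor_) (thueMorse-suc-double n)) (sym (not-xor b (thueMorse n)))

thueMorseℤ-suc-double : ∀ b k → thueMorseℤ b (ℤ.suc (k ℤ.+ k)) ≡ not (thueMorseℤ (not b) k)
thueMorseℤ-suc-double b (+ n)    = thueMorse-suc-double n
thueMorseℤ-suc-double b -[1+ n ] =
  trans (cong (b xor_) (thueMorse-double n))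
        (sym (trans (cong not (not-xor b (thueMorse n)))
             (trans (not-distribʳ-xor b _) (cong (b xor_) (not-involutive _)))))

thueMorseℤ-flip : ∀ b k → thueMorseℤ b (ℤ.suc (k ℤ.+ k)) ≡ not (thueMorseℤ b (k ℤ.+ k))
thueMorseℤ-flip b k =
  trans (thueMorseℤ-suc-double b k) (cong not (sym (thueMorseℤ-double b k)))

data Parityℕ : ℕ → Set where
  even : ∀ n → Parityℕ (n + n)
  odd  : ∀ n → Parityℕ (suc (n + n))

parityℕ : ∀ n → Parityℕ n
parityℕ zero = even 0
parityℕ (suc n) with parityℕ n
... | even m = odd m
... | odd m  = subst Parityℕ (cong suc (+-suc m m)) (even (suc m))

data Parityℤ : ℤ → Set where
  even : ∀ k → Parityℤ (k ℤ.+ k)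
  odd  : ∀ k → Parityℤ (ℤ.suc (k ℤ.+ k))

parityℤ : ∀ i → Parityℤ i
parityℤ (+ n) with parityℕ n
... | even m = even (+ m)
... | odd m  = odd (+ m)
-- `-[1+ n ]` is -1 - n, whose parity is opposite to that of n.
parityℤ -[1+ n ] with parityℕ n
... | even m = odd -[1+ m ]
... | odd m  = even -[1+ m ]

double-shift : ∀ k j → (k ℤ.+ k) ℤ.+ (j ℤ.+ j) ≡ (k ℤ.+ j) ℤ.+ (k ℤ.+ j)
double-shift = ℤ-Solver.solve-∀

suc-double-shift : ∀ k j →
  ℤ.suc (k ℤ.+ k) ℤ.+ (j ℤ.+ j) ≡ ℤ.suc ((k ℤ.+ j) ℤ.+ (k ℤ.+ j))
suc-double-shift = suc-double-shift′
  where
  suc-double-shift′ : ∀ k j →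
    (ℤ.1ℤ ℤ.+ (k ℤ.+ k)) ℤ.+ (j ℤ.+ j) ≡ ℤ.1ℤ ℤ.+ ((k ℤ.+ j) ℤ.+ (k ℤ.+ j))
  suc-double-shift′ = ℤ-Solver.solve-∀

odd+odd : ∀ i k q j → i ℤ.+ j ≡ ℤ.1ℤ ℤ.+ (k ℤ.+ k) →
  (k ℤ.+ (ℤ.1ℤ ℤ.+ q)) ℤ.+ (k ℤ.+ (ℤ.1ℤ ℤ.+ q)) ≡ i ℤ.+ ((ℤ.1ℤ ℤ.+ (q ℤ.+ q)) ℤ.+ j)
odd+odd i k q j eq = trans (lhs k q) (trans (cong (ℤ._+ (ℤ.1ℤ ℤ.+ (q ℤ.+ q))) (sym eq)) (rhs i j q))
  where
  lhs : ∀ k q → (k ℤ.+ (ℤ.1ℤ ℤ.+ q)) ℤ.+ (k ℤ.+ (ℤ.1ℤ ℤ.+ q)) ≡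
                (ℤ.1ℤ ℤ.+ (k ℤ.+ k)) ℤ.+ (ℤ.1ℤ ℤ.+ (q ℤ.+ q))
  lhs = ℤ-Solver.solve-∀
  rhs : ∀ i j q → (i ℤ.+ j) ℤ.+ (ℤ.1ℤ ℤ.+ (q ℤ.+ q)) ≡ i ℤ.+ ((ℤ.1ℤ ℤ.+ (q ℤ.+ q)) ℤ.+ j)
  rhs = ℤ-Solver.solve-∀

+-suc-shift : ∀ i j → i ℤ.+ + suc j ≡ ℤ.suc (i ℤ.+ + j)
+-suc-shift i j = lemma i (+ j)
  where
  lemma : ∀ i j → i ℤ.+ (ℤ.1ℤ ℤ.+ j) ≡ ℤ.1ℤ ℤ.+ (i ℤ.+ j)
  lemma = ℤ-Solver.solve-∀

alternating : (s : ℕ → Bool) → ∀ q →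
  (∀ {j} → j < suc (q + q) → s (suc j) ≡ not (s j)) → s (suc (q + q)) ≡ not (s 0)
alternating s zero    alt = alt (s≤s z≤n)
alternating s (suc q) alt rewrite +-suc q q =
  trans (alt ≤-refl) (cong not (trans (alt (n≤1+n _)) (trans (cong not
    (alternating s q (λ j< → alt (m≤n⇒m≤1+n (m≤n⇒m≤1+n j<))))) (not-involutive _))))

-- A factor of length 2p + 1 with period p: the bound `j ≤ p` takes in one letter past the square.
Overlap : Bool → ℤ → ℕ → Set
Overlap b i p = ∀ {j} → j ≤ p → thueMorseℤ b (i ℤ.+ + j) ≡ thueMorseℤ b (i ℤ.+ + (p + j))

interchange : ∀ q j → (q + q) + (j + j) ≡ (q + j) + (q + j)
interchange q j = ℤ.+-injective (double-shift (+ q) (+ j))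

-- Reading every second letter halves the period: the letters at even positions, and the complements
-- of those at odd ones, form the two-sided word again, with the other continuation to the left.
overlap-halve : ∀ b i q → Overlap b i (q + q) → ∃ λ k → Overlap (not b) k q
overlap-halve b i q o with parityℤ i
... | even k = k , λ {j} j≤q →
  trans (sym (half j)) (trans (o (+-mono-≤ j≤q j≤q))
    (trans (cong (λ m → thueMorseℤ b ((k ℤ.+ k) ℤ.+ + m)) (interchange q j)) (half (q + j))))
  where
  half : ∀ j → thueMorseℤ b ((k ℤ.+ k) ℤ.+ + (j + j)) ≡ thueMorseℤ (not b) (k ℤ.+ + j)
  half j = trans (cong (thueMorseℤ b) (double-shift k (+ j))) (thueMorseℤ-double b (k ℤ.+ + j))
... | odd k = k , λ {j} j≤q → not-injective
  (trans (sym (half j)) (trans (o (+-mono-≤ j≤q j≤q))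
    (trans (cong (λ m → thueMorseℤ b (ℤ.suc (k ℤ.+ k) ℤ.+ + m)) (interchange q j)) (half (q + j)))))
  where
  half : ∀ j → thueMorseℤ b (ℤ.suc (k ℤ.+ k) ℤ.+ + (j + j)) ≡ not (thueMorseℤ (not b) (k ℤ.+ + j))
  half j = trans (cong (thueMorseℤ b) (suc-double-shift k (+ j))) (thueMorseℤ-suc-double b (k ℤ.+ + j))

-- For an odd period one of the positions i + j and i + p + j is even, so the
-- word alternates over the whole first period, which odd length forbids.
no-odd-overlap : ∀ b i q → ¬ Overlap b i (suc (q + q))
no-odd-overlap b i q o =
  not-¬ (trans (o z≤n) (cong s (+-identityʳ p))) (sym
    (trans (cong not (alternating s q alternates)) (not-involutive _)))
  where
  p = suc (q + q)
  s : ℕ → Bool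
  s j = thueMorseℤ b (i ℤ.+ + j)
  flip : ∀ j k → k ℤ.+ k ≡ i ℤ.+ + j → s (suc j) ≡ not (s j)
  flip j k eq = trans (cong (thueMorseℤ b) (trans (+-suc-shift i j) (cong ℤ.suc (sym eq))))
    (trans (thueMorseℤ-flip b k) (cong (λ m → not (thueMorseℤ b m)) eq))
  alternates : ∀ {j} → j < p → s (suc j) ≡ not (s j)
  alternates {j} j<p with i ℤ.+ + j in eq | parityℤ (i ℤ.+ + j)
  ... | _ | even k = subst (λ m → s (suc j) ≡ not (thueMorseℤ b m)) eq (flip j k (sym eq))
  ... | _ | odd k  = subst (λ m → s (suc j) ≡ not (thueMorseℤ b m)) eq
    (trans (o j<p) (trans (cong s (+-suc p j))
      (trans (flip (p + j) (k ℤ.+ + suc q) (odd+odd i k (+ q) (+ j) eq)) (cong not (sym (o (<⇒≤ j<p)))))))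

-- Descent on the period: odd periods are impossible and even ones are halved. Halving changes `b`,
-- so the induction ranges over both values.
overlap-free : ∀ p → 0 < p → ∀ b i → ¬ Overlap b i p
overlap-free = <-rec (λ p → 0 < p → ∀ b i → ¬ Overlap b i p) step
  where
  step : ∀ p → (∀ {q} → q < p → 0 < q → ∀ b i → ¬ Overlap b i q) →
         0 < p → ∀ b i → ¬ Overlap b i p
  step p rec 0<p b i o with parityℕ p
  ... | odd q = no-odd-overlap b i q o
  ... | even (suc q) = let k , o′ = overlap-halve b i (suc q) o in
    rec (m<m+n (suc q) (s≤s z≤n)) (s≤s z≤n) (not b) k o′

-- The ternary word

difference : Bool → Bool → Fin 3
difference false true  = zero
difference true  false = suc zero
difference false false = suc (suc zero)
difference true  true  = suc (suc zero)

difference-injectiveʳ : ∀ a {b c} → difference a b ≡ difference a c → b ≡ c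
difference-injectiveʳ false {false} {false} _ = refl
difference-injectiveʳ false {true}  {true}  _ = refl
difference-injectiveʳ true  {false} {false} _ = refl
difference-injectiveʳ true  {true}  {true}  _ = refl

-- A bit rises only from 0 and falls only from 1, so equal steps from different bits leave both
-- unchanged.
difference-≢ : ∀ {a b c d} → a ≢ c → difference a b ≡ difference c d → b ≡ a × d ≡ c
difference-≢ {false} {_}     {false} {_}     a≢c _ = contradiction refl a≢c
difference-≢ {true}  {_}     {true}  {_}     a≢c _ = contradiction refl a≢c
difference-≢ {false} {false} {true}  {true}  _ _ = refl , refl
difference-≢ {true}  {true}  {false} {false} _ _ = refl , refl
difference-≢ {false} {false} {true}  {false} _ ()
difference-≢ {false} {true}  {true}  {false} _ ()
difference-≢ {true}  {false} {false} {true}  _ ()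
difference-≢ {true}  {true}  {false} {true}  _ ()

module _ (s : ℕ → Bool) (p : ℕ)
         (eq : ∀ {j} → j < p → difference (s j) (s (suc j)) ≡ difference (s (p + j)) (s (suc (p + j))))
  where

  equal-start : s 0 ≡ s p → ∀ {j} → j ≤ p → s j ≡ s (p + j)
  equal-start s0≡sp {zero}  _   = trans s0≡sp (cong s (sym (+-identityʳ p)))
  equal-start s0≡sp {suc j} j<p = trans
    (difference-injectiveʳ (s j) (trans (eq j<p)
      (cong (λ b → difference b (s (suc (p + j)))) (sym (equal-start s0≡sp (<⇒≤ j<p))))))
    (cong s (sym (+-suc p j)))

  -- The differences must then all vanish.
  unequal-start : s 0 ≢ s p → ∀ {j} → j ≤ p → s j ≡ s 0 × s (p + j) ≡ s p
  unequal-start s0≢sp {zero}  _   = refl , cong s (+-identityʳ p)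
  unequal-start s0≢sp {suc j} j<p with unequal-start s0≢sp (<⇒≤ j<p)
  ... | sj≡ , spj≡ with difference-≢ (λ e → s0≢sp (trans (sym sj≡) (trans e spj≡))) (eq j<p)
  ... | e , e′ = trans e sj≡ , trans (cong s (+-suc p j)) (trans e′ spj≡)

  -- A square of 2p differences spans 2p + 1 letters and is an overlap once both halves start with
  -- the same letter. Otherwise every difference vanishes, and following the first half to its end
  -- gives `s p ≡ s 0` after all.
  difference-square⇒overlap : ∀ {j} → j ≤ p → s j ≡ s (p + j)
  difference-square⇒overlap with s 0 ≟ᵇ s p
  ... | yes e = equal-start e
  ... | no ne = contradiction (sym (proj₁ (unequal-start ne ≤-refl))) ne

ternary : ℤ → Fin 3
ternary i = difference (thueMorseℤ false i) (thueMorseℤ false (ℤ.suc i))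

data Run : ℤ → List ℤ → Set where
  []  : ∀ {i} → Run i []
  _∷_ : ∀ i {is} → Run (ℤ.suc i) is → Run i (i ∷ is)

suc-+ : ∀ i j → ℤ.suc i ℤ.+ + j ≡ i ℤ.+ + suc j
suc-+ i j = lemma i (+ j)
  where
  lemma : ∀ i j → (ℤ.1ℤ ℤ.+ i) ℤ.+ j ≡ i ℤ.+ (ℤ.1ℤ ℤ.+ j)
  lemma = ℤ-Solver.solve-∀

run-++ : ∀ {i} M {N} → Run i (M ++ N) → Run i M × Run (i ℤ.+ + length M) N
run-++ {i} [] r = [] , subst (λ k → Run k _) (sym (ℤ.+-identityʳ i)) r
run-++ (_ ∷ M) (i ∷ r) = let r₁ , r₂ = run-++ M r in
  i ∷ r₁ , subst (λ k → Run k _) (suc-+ i (length M)) r₂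

run-pointwise : ∀ {A : Set} (f : ℤ → A) {i k M N} → Run i M → Run k N → map f M ≡ map f N →
  ∀ {j} → j < length M → f (i ℤ.+ + j) ≡ f (k ℤ.+ + j)
run-pointwise f (i ∷ r) (k ∷ r′) eq {zero} _ =
  trans (cong f (ℤ.+-identityʳ i)) (trans (proj₁ (∷-injective eq)) (cong f (sym (ℤ.+-identityʳ k))))
run-pointwise f (i ∷ r) (k ∷ r′) eq {suc j} (s≤s j<) =
  trans (cong f (sym (suc-+ i j))) (trans (run-pointwise f r r′ (proj₂ (∷-injective eq)) j<) (cong f (suc-+ k j)))

ternary-square-free : ∀ {i} M {N} → Run i (M ++ N) → map ternary M ≡ map ternary N → M ≡ []
ternary-square-free []       _ _ = refl
ternary-square-free {i} M@(m ∷ M′) r eq = contradiction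
  (λ {j} → difference-square⇒overlap s p squares {j})
  (overlap-free p (s≤s z≤n) false i)
  where
  p = length M
  s : ℕ → Bool
  s j = thueMorseℤ false (i ℤ.+ + j)
  at : ∀ j → ternary (i ℤ.+ + j) ≡ difference (s j) (s (suc j))
  at j = cong (λ k → difference (s j) (thueMorseℤ false k)) (sym (+-suc-shift i j))
  squares : ∀ {j} → j < p → difference (s j) (s (suc j)) ≡ difference (s (p + j)) (s (suc (p + j)))
  squares {j} j<p = let r₁ , r₂ = run-++ M r in
    trans (sym (at j)) (trans (run-pointwise ternary r₁ r₂ eq j<p)
      (trans (cong ternary (ℤ.+-assoc i (+ p) (+ j))) (at (p + j))))

ternary-suc-≢ : ∀ i → ternary (ℤ.suc i) ≢ ternary i
ternary-suc-≢ i eq with () ← ternary-square-free (i ∷ []) (i ∷ (ℤ.suc i ∷ [])) (cong (_∷ []) (sym eq))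

-- The four-letter word

-- i, i + 1, ∗, i + 2, i + 3, ∗, …: the separators make any three consecutive
-- letters distinct.
separated : ℤ → ℕ → Maybe ℤ
separated i 0 = just i
separated i 1 = just (ℤ.suc i)
separated i 2 = nothing
separated i (suc (suc (suc n))) = separated (ℤ.suc (ℤ.suc i)) n

-- The integer carried by the first position from n on that is not a separator.
next : ℤ → ℕ → ℤ
next i 0 = i
next i 1 = ℤ.suc i
next i 2 = ℤ.suc (ℤ.suc i)
next i (suc (suc (suc n))) = next (ℤ.suc (ℤ.suc i)) n

separated-next : ∀ i n →
  (separated i n ≡ just (next i n) × next i (suc n) ≡ ℤ.suc (next i n)) ⊎
  (separated i n ≡ nothing × next i (suc n) ≡ next i n)
separated-next i 0 = inj₁ (refl , refl)
separated-next i 1 = inj₁ (refl , refl)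
separated-next i 2 = inj₂ (refl , refl)
separated-next i (suc (suc (suc n))) = separated-next (ℤ.suc (ℤ.suc i)) n

upFrom : ℕ → ℕ → List ℕ
upFrom m zero    = []
upFrom m (suc n) = m ∷ upFrom (suc m) n

upFrom-++ : ∀ m n k → upFrom m n ++ upFrom (m + n) k ≡ upFrom m (n + k)
upFrom-++ m zero    k = cong (λ x → upFrom x k) (+-identityʳ m)
upFrom-++ m (suc n) k = cong (m ∷_)
  (trans (cong (λ x → upFrom (suc m) n ++ upFrom x k) (+-suc m n)) (upFrom-++ (suc m) n k))

run-cast : ∀ {i j is} → i ≡ j → Run i is → Run j is
run-cast refl r = r

-- Deleting the separators from a square in the four-letter word thus leaves a factor of the ternary
-- word, to which `ternary-square-free` applies.
run-separated : ∀ i m n → Run (next i m) (mapMaybe (separated i) (upFrom m n))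
run-separated i m zero = []
run-separated i m (suc n) with separated-next i m
... | inj₁ (e , e′) rewrite e =
  next i m ∷ run-cast e′ (run-separated i (suc m) n)
... | inj₂ (e , e′) rewrite e = run-cast e′ (run-separated i (suc m) n)

levelLetter : ℕ → Maybe (Fin 3)
levelLetter n = Maybe.map ternary (separated (+ 0) n)

levelLetter-1-≢ : ∀ n → levelLetter (suc n) ≢ levelLetter n
levelLetter-1-≢ = go (+ 0)
  where
  go : ∀ i n → Maybe.map ternary (separated i (suc n)) ≢ Maybe.map ternary (separated i n)
  go i 0 eq = ternary-suc-≢ i (just-injective eq)
  go i (suc (suc (suc n))) eq = go (ℤ.suc (ℤ.suc i)) n eq

-- Of two positions at distance two, either exactly one is a separator, or they surround one and
-- carry consecutive integers.
levelLetter-2-≢ : ∀ n → levelLetter (suc (suc n)) ≢ levelLetter n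
levelLetter-2-≢ = go (+ 0)
  where
  go : ∀ i n → Maybe.map ternary (separated i (suc (suc n))) ≢ Maybe.map ternary (separated i n)
  go i 1 eq = ternary-suc-≢ (ℤ.suc i) (just-injective eq)
  go i (suc (suc (suc n))) eq = go (ℤ.suc (ℤ.suc i)) n eq

map-upFrom-cong : ∀ {A : Set} (f : ℕ → A) c m n →
  (∀ {x} → m ≤ x → x < m + n → f x ≡ f (x + c)) → map f (upFrom m n) ≡ map f (upFrom (m + c) n)
map-upFrom-cong f c m zero    eq = refl
map-upFrom-cong f c m (suc n) eq = cong₂ _∷_
  (eq ≤-refl (m<m+n m (s≤s z≤n)))
  (map-upFrom-cong f c (suc m) n λ {x} m<x x< →
    eq (<⇒≤ m<x) (subst (x <_) (sym (+-suc m n)) x<))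

mapMaybe-∷-[] : ∀ {A B : Set} (f : A → Maybe B) x xs → mapMaybe f (x ∷ xs) ≡ [] →
  f x ≡ nothing × mapMaybe f xs ≡ []
mapMaybe-∷-[] f x xs eq with f x
mapMaybe-∷-[] f x xs eq | nothing = refl , eq

-- Deleting the separators leaves a square in the ternary word, so each half consists of separators
-- only. Two adjacent letters are then equal, against `levelLetter-1-≢`.
levelLetter-square-free : ∀ m c → 0 < c →
  ¬ (∀ {x} → m ≤ x → x < m + c → levelLetter x ≡ levelLetter (x + c))
levelLetter-square-free m c@(suc c′) _ eq =
  levelLetter-1-≢ m (sym (repeats c′ M≡[] (eq ≤-refl (m<m+n m (s≤s z≤n)))))
  where
  letters : List ℕ → List ℤ
  letters = mapMaybe (separated (+ 0))
  M = letters (upFrom m c)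
  N = letters (upFrom (m + c) c)
  M++N : letters (upFrom m (c + c)) ≡ M ++ N
  M++N = trans (cong letters (sym (upFrom-++ m c c))) (mapMaybe-++ (separated (+ 0)) (upFrom m c) _)
  map≡ : map levelLetter (upFrom m c) ≡ map levelLetter (upFrom (m + c) c)
  map≡ = map-upFrom-cong levelLetter c m c eq
  M≗N : map ternary M ≡ map ternary N
  M≗N = trans (map-mapMaybe ternary (separated (+ 0)) (upFrom m c))
    (trans (cong catMaybes map≡) (sym (map-mapMaybe ternary (separated (+ 0)) (upFrom (m + c) c))))
  M≡[] : M ≡ []
  M≡[] = ternary-square-free M (subst (Run _) M++N (run-separated (+ 0) m (c + c))) M≗N
  repeats : ∀ c′ → letters (upFrom m (suc c′)) ≡ [] →
    levelLetter m ≡ levelLetter (m + suc c′) → levelLetter m ≡ levelLetter (suc m)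
  -- Halves of length one make adjacent letters equal by themselves; longer ones start with two
  -- separators.
  repeats zero     _  e = trans e (cong levelLetter (+-comm m 1))
  repeats (suc c″) e₀ _ =
    let e₁ , e₂ = mapMaybe-∷-[] (separated (+ 0)) m (upFrom (suc m) (suc c″)) e₀
        e₃ , _  = mapMaybe-∷-[] (separated (+ 0)) (suc m) (upFrom (suc (suc m)) c″) e₂
    in trans (cong (Maybe.map ternary) e₁) (cong (Maybe.map ternary) (sym e₃))

-- Walks on the levels

data Step : ℕ → ℕ → Set where
  stay : ∀ {x} → Step x x
  up   : ∀ {x} → Step x (suc x)
  down : ∀ {x} → Step (suc x) x

Walk : List ℕ → Set
Walk = Linked Step

private variable
  p q : ℕ
  ps qs : List ℕ

m<n⇒∃+ : ∀ {m n} → m < n → ∃ λ c → suc c + m ≡ n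
m<n⇒∃+ {m} {suc n} (s≤s m≤n) = n ∸ m , cong suc (m∸n+n≡m m≤n)

step-≤ : ∀ {x y} → Step x y → y ≤ suc x × x ≤ suc y
step-≤ stay = n≤1+n _ , n≤1+n _
step-≤ up   = ≤-refl , m≤n⇒m≤1+n (n≤1+n _)
step-≤ down = m≤n⇒m≤1+n (n≤1+n _) , ≤-refl

-- Discrete intermediate values: no step jumps over a level. Since `v` lies strictly below `q`, it
-- is met before the second half starts.
visits-up : ∀ {v} p ps → Walk (p ∷ ps ++ q ∷ qs) → p ≤ v → v < q → v ∈ p ∷ ps
visits-up p ps w p≤v v<q with m≤n⇒m<n∨m≡n p≤v
... | inj₂ refl = here refl
visits-up p []        (s ∷ _) _ v<q | inj₁ p<v =
  contradiction (<-≤-trans v<q (≤-trans (proj₁ (step-≤ s)) p<v)) (<-irrefl refl)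
visits-up p (p′ ∷ ps) (s ∷ w) _ v<q | inj₁ p<v =
  there (visits-up p′ ps w (≤-trans (proj₁ (step-≤ s)) p<v) v<q)

visits-down : ∀ {v} p ps → Walk (p ∷ ps ++ q ∷ qs) → v ≤ p → q < v → v ∈ p ∷ ps
visits-down p ps w v≤p q<v with m≤n⇒m<n∨m≡n v≤p
... | inj₂ refl = here refl
visits-down p []        (s ∷ _) _ q<v | inj₁ v<p =
  contradiction (<-≤-trans v<p (≤-trans (proj₂ (step-≤ s)) q<v)) (<-irrefl refl)
visits-down p (p′ ∷ ps) (s ∷ w) _ q<v | inj₁ v<p =
  there (visits-down p′ ps w (s≤s⁻¹ (≤-trans v<p (proj₂ (step-≤ s)))) q<v)

-- Two levels symmetric about the centre of the interval from p to p + d + 1, hence exchanged by the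
-- reflection; their distance depends on the parity of d.
midpoint : ∀ p d → ∃₂ λ x y →
  p ≤ x × y ≤ suc d + p × x + y ≡ p + (suc d + p) × (y ≡ suc x ⊎ y ≡ suc (suc x))
midpoint p 0 = p , suc p , ≤-refl , ≤-refl , refl , inj₁ refl
midpoint p 1 = p , suc (suc p) , ≤-refl , ≤-refl , refl , inj₂ refl
midpoint p (suc (suc d)) with midpoint (suc p) d
... | x , y , p<x , y≤ , eq , close = x , y , <⇒≤ p<x ,
  ≤-trans y≤ (≤-trans (≤-reflexive (+-suc (suc d) p)) (n≤1+n _)) ,
  trans eq (trans (cong (λ k → suc p + suc k) (+-suc d p)) (sym (+-suc p _))) , close

walk-++ˡ : ∀ xs {ys} → Walk (xs ++ ys) → Walk xs
walk-++ˡ []           _       = []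
walk-++ˡ (x ∷ [])     _       = [-]
walk-++ˡ (x ∷ y ∷ xs) (s ∷ w) = s ∷ walk-++ˡ (y ∷ xs) w

walk-++ʳ : ∀ xs {ys} → Walk (xs ++ ys) → Walk ys
walk-++ʳ []               w       = w
walk-++ʳ (x ∷ []) {[]}    _       = []
walk-++ʳ (x ∷ []) {_ ∷ _} (s ∷ w) = w
walk-++ʳ (x ∷ y ∷ xs)     (s ∷ w) = walk-++ʳ (y ∷ xs) w

module Walks {A : Set} (f : ℕ → A)
  (f-1-≢ : ∀ n → f (suc n) ≢ f n)
  (f-2-≢ : ∀ n → f (suc (suc n)) ≢ f n)
  (f-square-free : ∀ m c → 0 < c → ¬ (∀ {x} → m ≤ x → x < m + c → f x ≡ f (x + c)))
  where

  step-injective : ∀ {x y z} → Step x y → Step x z → f y ≡ f z → y ≡ z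
  step-injective stay stay _  = refl
  step-injective up   up   _  = refl
  step-injective down down _  = refl
  step-injective stay up   eq = contradiction (sym eq) (f-1-≢ _)
  step-injective stay down eq = contradiction eq (f-1-≢ _)
  step-injective up   stay eq = contradiction eq (f-1-≢ _)
  step-injective up   down eq = contradiction eq (f-2-≢ _)
  step-injective down stay eq = contradiction (sym eq) (f-1-≢ _)
  step-injective down up   eq = contradiction (sym eq) (f-2-≢ _)

  walk-injective : ∀ {x ys zs} → Walk (x ∷ ys) → Walk (x ∷ zs) →
    map f ys ≡ map f zs → ys ≡ zs
  walk-injective [-]      [-]      _  = refl
  walk-injective (s ∷ ss) (t ∷ ts) eq with ∷-injective eq
  ... | e , es with refl ← step-injective s t e = cong (_ ∷_) (walk-injective ss ts es)

  -- For the current levels of two walks, the first excludes next moves in opposite directions, the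
  -- second excludes that both go up or both go down. The equations supply the predecessors for
  -- moves down.
  NoReflection NoTranslation : ℕ → ℕ → Set
  NoReflection p q =
    (∀ {y} → q ≡ suc y → f (suc p) ≢ f y) ×
    (∀ {x} → p ≡ suc x → f x ≢ f (suc q))
  NoTranslation p q =
    (f (suc p) ≢ f (suc q)) ×
    (∀ {x y} → p ≡ suc x → q ≡ suc y → f x ≢ f y)

  -- The partner y of x is x + q - p or p + q - x, written without subtraction; its existence
  -- includes that it is not negative.
  Translates Reflects : ℕ → ℕ → List ℕ → Set
  Translates p q xs = ∀ {x} → x ∈ xs → ∃ λ y → f x ≡ f y × x + q ≡ y + p
  Reflects   p q xs = ∀ {x} → x ∈ xs → ∃ λ y → f x ≡ f y × x + y ≡ p + q

  -- The levels just left carry the same letter. Of two opposite moves one returns to the level just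
  -- left and the other ends two levels away from it, so `f` would repeat at distance two. The three
  -- lemmas below are alike.
  up-up : f p ≡ f q → NoReflection (suc p) (suc q)
  up-up e = (λ { refl e′ → f-2-≢ _ (trans e′ (sym e)) }) ,
            (λ { refl e′ → f-2-≢ _ (trans (sym e′) e) })

  down-down : f (suc p) ≡ f (suc q) → NoReflection p q
  down-down e = (λ { refl e′ → f-2-≢ _ (trans (sym e) e′) }) ,
                (λ { refl e′ → f-2-≢ _ (trans e (sym e′)) })

  up-down : f p ≡ f (suc q) → NoTranslation (suc p) q
  up-down e = (λ e′ → f-2-≢ _ (trans e′ (sym e))) ,
              (λ { refl refl e′ → f-2-≢ _ (trans (sym e) e′) })

  down-up : f (suc p) ≡ f q → NoTranslation p (suc q)
  down-up e = (λ e′ → f-2-≢ _ (trans (sym e′) e)) ,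
              (λ { refl refl e′ → f-2-≢ _ (trans e (sym e′)) })

  stay-move : f p ≡ f q → f p ≢ f (suc q)
  stay-move e e′ = f-1-≢ _ (trans (sym e′) e)

  stay-move′ : f p ≡ f (suc q) → f p ≢ f q
  stay-move′ e e′ = f-1-≢ _ (trans (sym e) e′)

  translates-∷ : f p ≡ f q → Translates p q ps → Translates p q (p ∷ ps)
  translates-∷ {p} {q} e t (here refl) = q , e , +-comm p q
  translates-∷ e t (there x∈)  = t x∈

  reflects-∷ : f p ≡ f q → Reflects p q ps → Reflects p q (p ∷ ps)
  reflects-∷ e t (here refl) = _ , e , refl
  reflects-∷ e t (there x∈)  = t x∈

  translates-up : Translates (suc p) (suc q) ps → Translates p q ps
  translates-up {p} {q} t {x} x∈ with t x∈
  ... | y , e , e′ = y , e , suc-injective (trans (sym (+-suc x q)) (trans e′ (+-suc y p)))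

  translates-down : Translates p q ps → Translates (suc p) (suc q) ps
  translates-down {p} {q} t {x} x∈ with t x∈
  ... | y , e , e′ = y , e , trans (+-suc x q) (trans (cong suc e′) (sym (+-suc y p)))

  reflects-up : Reflects (suc p) q ps → Reflects p (suc q) ps
  reflects-up {p} {q} t x∈ with t x∈
  ... | y , e , e′ = y , e , trans e′ (sym (+-suc p q))

  reflects-down : Reflects p (suc q) ps → Reflects (suc p) q ps
  reflects-down {p} {q} t x∈ with t x∈
  ... | y , e , e′ = y , e , trans e′ (+-suc p q)

  translates : NoReflection p q → Walk (p ∷ ps) → Walk (q ∷ qs) →
    map f (p ∷ ps) ≡ map f (q ∷ qs) → Translates p q (p ∷ ps)
  translates nr [-] [-] eq = translates-∷ (proj₁ (∷-injective eq)) λ ()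
  translates nr (s ∷ ss) (t ∷ ts) eq with ∷-injective eq
  ... | e , es with s | t | proj₁ (∷-injective es)
  ... | stay | stay | _  = translates-∷ e (translates nr ss ts es)
  ... | stay | up   | e′ = contradiction e′ (stay-move e)
  ... | stay | down | e′ = contradiction e′ (stay-move′ e)
  ... | up   | stay | e′ = contradiction (sym e′) (stay-move (sym e))
  ... | down | stay | e′ = contradiction (sym e′) (stay-move′ (sym e))
  ... | up   | up   | _  = translates-∷ e (translates-up (translates (up-up e) ss ts es))
  ... | down | down | _  = translates-∷ e (translates-down (translates (down-down e) ss ts es))
  ... | up   | down | e′ = contradiction e′ (proj₁ nr refl)
  ... | down | up   | e′ = contradiction e′ (proj₂ nr refl)

  reflects : NoTranslation p q → Walk (p ∷ ps) → Walk (q ∷ qs) →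
    map f (p ∷ ps) ≡ map f (q ∷ qs) → Reflects p q (p ∷ ps)
  reflects nt [-] [-] eq = reflects-∷ (proj₁ (∷-injective eq)) λ ()
  reflects nt (s ∷ ss) (t ∷ ts) eq with ∷-injective eq
  ... | e , es with s | t | proj₁ (∷-injective es)
  ... | stay | stay | _  = reflects-∷ e (reflects nt ss ts es)
  ... | stay | up   | e′ = contradiction e′ (stay-move e)
  ... | stay | down | e′ = contradiction e′ (stay-move′ e)
  ... | up   | stay | e′ = contradiction (sym e′) (stay-move (sym e))
  ... | down | stay | e′ = contradiction (sym e′) (stay-move′ (sym e))
  ... | up   | up   | e′ = contradiction e′ (proj₁ nt)
  ... | down | down | e′ = contradiction e′ (proj₂ nt refl refl)
  ... | up   | down | _  = reflects-∷ e (reflects-up (reflects (up-down e) ss ts es))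
  ... | down | up   | _  = reflects-∷ e (reflects-down (reflects (down-up e) ss ts es))

  -- The first moves of the two walks go the same way or opposite ways, and since
  -- any three consecutive letters are distinct this persists to the end.
  translates-or-reflects : Walk (p ∷ ps) → Walk (q ∷ qs) →
    map f (p ∷ ps) ≡ map f (q ∷ qs) →
    Translates p q (p ∷ ps) ⊎ Reflects p q (p ∷ ps)
  translates-or-reflects [-] [-] eq = inj₁ (translates-∷ (proj₁ (∷-injective eq)) λ ())
  translates-or-reflects (s ∷ ss) (t ∷ ts) eq with ∷-injective eq
  ... | e , es with s | t | proj₁ (∷-injective es)
  ... | stay | stay | _  = Sum.map (translates-∷ e) (reflects-∷ e) (translates-or-reflects ss ts es)
  ... | stay | up   | e′ = contradiction e′ (stay-move e)
  ... | stay | down | e′ = contradiction e′ (stay-move′ e)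
  ... | up   | stay | e′ = contradiction (sym e′) (stay-move (sym e))
  ... | down | stay | e′ = contradiction (sym e′) (stay-move′ (sym e))
  ... | up   | up   | _  = inj₁ (translates-∷ e (translates-up (translates (up-up e) ss ts es)))
  ... | down | down | _  = inj₁ (translates-∷ e (translates-down (translates (down-down e) ss ts es)))
  ... | up   | down | _  = inj₂ (reflects-∷ e (reflects-up (reflects (up-down e) ss ts es)))
  ... | down | up   | _  = inj₂ (reflects-∷ e (reflects-down (reflects (down-up e) ss ts es)))

  close-≢ : ∀ {x y} → y ≡ suc x ⊎ y ≡ suc (suc x) → f y ≢ f x
  close-≢ (inj₁ refl) = f-1-≢ _
  close-≢ (inj₂ refl) = f-2-≢ _

  close-< : ∀ {x y} → y ≡ suc x ⊎ y ≡ suc (suc x) → x < y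
  close-< (inj₁ refl) = ≤-refl
  close-< (inj₂ refl) = n≤1+n _

  -- If the halves start at different levels, the first half visits the levels between them: enough
  -- to read off a whole square in `f`, or to meet a close pair exchanged by the reflection.
  walk-square : ∀ p ps q qs → Walk (p ∷ ps ++ q ∷ qs) →
    map f (p ∷ ps) ≡ map f (q ∷ qs) → p ∷ ps ≡ q ∷ qs
  walk-square p ps q qs w eq
    with <-cmp p q | translates-or-reflects (walk-++ˡ (p ∷ ps) w) (walk-++ʳ (p ∷ ps) w) eq
  ... | tri≈ _ refl _ | _ =
    cong (p ∷_) (walk-injective (walk-++ˡ (p ∷ ps) w) (walk-++ʳ (p ∷ ps) w) (proj₂ (∷-injective eq)))
  ... | tri< p<q _ _ | inj₁ t with c , refl ← m<n⇒∃+ p<q =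
    ⊥-elim (f-square-free p (suc c) (s≤s z≤n) shift)
    where
    shift : ∀ {x} → p ≤ x → x < p + suc c → f x ≡ f (x + suc c)
    shift {x} p≤x x< with t (visits-up p ps w p≤x (subst (x <_) (+-comm p (suc c)) x<))
    ... | y , e , e′ = trans e (cong f (+-cancelʳ-≡ p y (x + suc c)
      (trans (sym e′) (sym (+-assoc x (suc c) p)))))
  ... | tri< p<q _ _ | inj₂ r with c , refl ← m<n⇒∃+ p<q with midpoint p c
  ... | x , y , p≤x , y≤q , e , close with r (visits-up p ps w p≤x (<-≤-trans (close-< close) y≤q))
  ... | y′ , e′ , e″ with refl ← +-cancelˡ-≡ x y′ y (trans e″ (sym e)) =
    contradiction (sym e′) (close-≢ close)
  -- The translation now goes down by c + 1. The square in `f` starts at the partner m of level q +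
  -- 1, whose existence keeps it from falling below level zero.
  walk-square p ps q qs w eq | tri> _ _ q<p | inj₁ t with c , refl ← m<n⇒∃+ q<p
    with t (visits-down p ps w (s≤s (m≤n+m q c)) ≤-refl)
  ... | m , _ , e = ⊥-elim (f-square-free m (suc c) (s≤s z≤n) shift)
    where
    m+c : m + suc c ≡ suc q
    m+c = +-cancelʳ-≡ q (m + suc c) (suc q) (trans (+-assoc m (suc c) q) (sym e))
    shift : ∀ {x} → m ≤ x → x < m + suc c → f x ≡ f (x + suc c)
    shift {x} m≤x x< with t (visits-down p ps w
        (≤-trans (+-monoˡ-≤ (suc c) (s≤s⁻¹ (≤-trans x< (≤-reflexive m+c)))) (≤-reflexive (+-comm q (suc c))))
        (≤-trans (≤-reflexive (sym m+c)) (+-monoˡ-≤ (suc c) m≤x)))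
    ... | y , e₁ , e₂ = sym (trans e₁ (cong f (+-cancelʳ-≡ (suc c + q) y x
      (trans (sym e₂) (+-assoc x (suc c) q)))))
  walk-square p ps q qs w eq | tri> _ _ q<p | inj₂ r with c , refl ← m<n⇒∃+ q<p with midpoint q c
  ... | x , y , q≤x , y≤p , e , close with r (visits-down p ps w y≤p (≤-<-trans q≤x (close-< close)))
  ... | x′ , e′ , e″ with refl ← +-cancelˡ-≡ y x′ x
        (trans e″ (trans (+-comm p q) (trans (sym e) (+-comm x y)))) =
    contradiction e′ (close-≢ close)

-- Layered words

open Walks levelLetter levelLetter-1-≢ levelLetter-2-≢ levelLetter-square-free using (walk-square)

Vertex : Set
Vertex = ℕ × ℤ

level : Vertex → ℕ
level = proj₁

index : Vertex → ℤ
index = proj₂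

private variable
  k l : ℕ
  i j : ℤ
  u v : Vertex
  vs ws : List Vertex

-- The first vertex at level at most k, if it is at level k, has index i + 1.
data Next (k : ℕ) (i : ℤ) : List Vertex → Set where
  none  : Next k i []
  lower : l < k → Next k i ((l , j) ∷ vs)
  found : Next k i ((k , ℤ.suc i) ∷ vs)
  skip  : k < l → Next k i vs → Next k i ((l , j) ∷ vs)

data Layered : List Vertex → Set where
  []  : Layered []
  [-] : Layered (v ∷ [])
  cons : Step (level u) (level v) → Next (level u) (index u) (v ∷ vs) →
         Layered (v ∷ vs) → Layered (u ∷ v ∷ vs)

-- The new vertex is not lower than its left neighbour, so a search from further left ends at the
-- same vertex as before; the last component records this for the recursion.
insert-after : ∀ u vs ws → Layered (u ∷ vs ++ ws) → ∃ λ v → Layered (u ∷ vs ++ v ∷ ws) ×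
  (∀ {k i} → Next k i (u ∷ vs ++ ws) → Next k i (u ∷ vs ++ v ∷ ws))
insert-after u [] ws lay = let v , u≤v , lay′ = between u ws lay in v , lay′ , extend-next u≤v
  where
  between : ∀ u ws → Layered (u ∷ ws) → ∃ λ v → level u ≤ level v × Layered (u ∷ v ∷ ws)
  -- At an end the level of the end vertex is kept; it is 0 in every word built up from the empty
  -- one.
  between (l , i) [] _ = (l , ℤ.suc i) , ≤-refl , cons stay found [-]
  -- The new vertex is alone on its path, cut off by lower vertices on both sides, so any index will
  -- do.
  between (l , i) ((_ , j) ∷ ws) (cons stay n lay′) =
    (suc l , + 0) , n≤1+n l , cons up (skip ≤-refl n) (cons down (lower ≤-refl) lay′)
  -- The path that starts at the right neighbour is prolonged to the left.
  between (l , i) ((_ , j) ∷ ws) (cons up n lay′) =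
    (suc l , ℤ.pred j) , n≤1+n l , cons up (skip ≤-refl n)
      (cons stay (subst (λ j′ → Next (suc l) (ℤ.pred j) ((suc l , j′) ∷ ws)) (ℤ.suc-pred j) found) lay′)
  between (l , i) ((_ , j) ∷ ws) (cons down n lay′) =
    (l , ℤ.suc i) , ≤-refl , cons stay found (cons down (lower ≤-refl) lay′)
  extend-next : ∀ {u v ws} → level u ≤ level v → ∀ {k i} → Next k i (u ∷ ws) → Next k i (u ∷ v ∷ ws)
  extend-next u≤v (lower l<k)  = lower l<k
  extend-next u≤v found        = found
  extend-next u≤v (skip k<l n) = skip k<l (skip (<-≤-trans k<l u≤v) n)
insert-after u (v ∷ vs) ws (cons s n lay) with insert-after v vs ws lay
... | w , lay′ , next = w , cons s (next n) lay′ , λ where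
  (lower l<k)  → lower l<k
  found        → found
  (skip k<l m) → skip k<l (next m)

insert : ∀ vs ws → Layered (vs ++ ws) → ∃ λ v → Layered (vs ++ v ∷ ws)
insert []       []             _   = (0 , + 0) , [-]
insert []       ((l , j) ∷ ws) lay = (l , ℤ.pred j) ,
  cons stay (subst (λ j′ → Next l (ℤ.pred j) ((l , j′) ∷ ws)) (ℤ.suc-pred j) found) lay
insert (u ∷ vs) ws lay = let v , lay′ , _ = insert-after u vs ws lay in v , lay′

layered-++ʳ : ∀ vs → Layered (vs ++ ws) → Layered ws
layered-++ʳ [] lay = lay
layered-++ʳ (v ∷ []) [-] = []
layered-++ʳ (v ∷ []) (cons _ _ lay) = lay
layered-++ʳ (v ∷ v′ ∷ vs) (cons _ _ lay) = layered-++ʳ (v′ ∷ vs) lay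

next-++ˡ : ∀ vs → Next k i (vs ++ ws) → Next k i vs
next-++ˡ []       _            = none
next-++ˡ (_ ∷ vs) (lower l<k)  = lower l<k
next-++ˡ (_ ∷ vs) found        = found
next-++ˡ (_ ∷ vs) (skip k<l n) = skip k<l (next-++ˡ vs n)

layered-++ˡ : ∀ vs → Layered (vs ++ ws) → Layered vs
layered-++ˡ []            _              = []
layered-++ˡ (v ∷ [])      _              = [-]
layered-++ˡ (v ∷ v′ ∷ vs) (cons s n lay) = cons s (next-++ˡ (v′ ∷ vs) n) (layered-++ˡ (v′ ∷ vs) lay)

layered⇒walk : Layered vs → Walk (map level vs)
layered⇒walk []             = []
layered⇒walk [-]            = [-]
layered⇒walk (cons s _ lay) = s ∷ layered⇒walk lay

layered-tail : Layered (v ∷ vs) → Layered vs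
layered-tail {v} lay = layered-++ʳ (v ∷ []) lay

layered-next : Layered (v ∷ vs) → Next (level v) (index v) vs
layered-next [-]          = none
layered-next (cons _ n _) = n

-- Indices on the lowest level

indices : ℕ → List Vertex → List ℤ
indices k [] = []
indices k ((l , i) ∷ vs) with l ≟ k
... | yes _ = i ∷ indices k vs
... | no _  = indices k vs

indices-++ : ∀ k vs ws → indices k (vs ++ ws) ≡ indices k vs ++ indices k ws
indices-++ k [] ws = refl
indices-++ k ((l , i) ∷ vs) ws with l ≟ k
... | yes _ = cong (i ∷_) (indices-++ k vs ws)
... | no _  = indices-++ k vs ws

-- With no level below k present, the search for the next vertex at level k is never cut off by a
-- lower one, so each index found is the successor of the previous one.
run-indices-next : Layered vs → All (λ v → k ≤ level v) vs → Next k i vs → Run (ℤ.suc i) (indices k vs)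
run-indices-next {[]} _ _ _ = []
run-indices-next {(l , j) ∷ vs} {k} lay (k≤l ∷ k≤vs) n with l ≟ k | n
... | yes refl | lower l<l  = contradiction l<l (<-irrefl refl)
... | yes refl | skip l<l _ = contradiction l<l (<-irrefl refl)
... | yes refl | found      = j ∷ run-indices-next (layered-tail lay) k≤vs (layered-next lay)
... | no _     | lower l<k  = contradiction (<-≤-trans l<k k≤l) (<-irrefl refl)
... | no k≢k   | found      = contradiction refl k≢k
... | no _     | skip _ n′  = run-indices-next (layered-tail lay) k≤vs n′

run-indices : Layered vs → All (λ v → k ≤ level v) vs → ∃ λ i → Run i (indices k vs)
run-indices {[]} _ _ = + 0 , []
run-indices {(l , j) ∷ vs} {k} lay (_ ∷ k≤vs) with l ≟ k
... | yes refl = j , j ∷ run-indices-next (layered-tail lay) k≤vs (layered-next lay)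
... | no _     = run-indices (layered-tail lay) k≤vs

minimum : ∀ x xs → ∃ λ k → k ∈ x ∷ xs × All (k ≤_) (x ∷ xs)
minimum x [] = x , here refl , ≤-refl ∷ []
minimum x (y ∷ xs) with minimum y xs
... | k , k∈ , k≤ with ≤-total x k
... | inj₁ x≤k = x , here refl , ≤-refl ∷ All.map (≤-trans x≤k) k≤
... | inj₂ k≤x = k , there k∈ , k≤x ∷ k≤

indices-nonempty : ∀ vs → k ∈ map level vs → indices k vs ≢ []
indices-nonempty {k} (v ∷ vs) k∈ eq with level v ≟ k | k∈
... | no l≢k | here refl = l≢k refl
... | no _   | there k∈′ = indices-nonempty vs k∈′ eq

-- Colours and squares of layered words

code : Maybe (Fin 3) → Fin 4
code nothing  = zero
code (just x) = suc x

code-injective : ∀ {x y} → code x ≡ code y → x ≡ y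
code-injective {nothing} {nothing} _  = refl
code-injective {just _}  {just _}  eq = cong just (Fin-suc-injective eq)

colour : Vertex → Fin 12
colour (l , i) = combine (code (levelLetter l)) (ternary i)

colour-injective : ∀ u v → colour u ≡ colour v →
  levelLetter (level u) ≡ levelLetter (level v) × ternary (index u) ≡ ternary (index v)
colour-injective (k , i) (l , j) eq = let e , e′ = combine-injective _ _ _ _ eq in code-injective e , e′

colours⇒letters : ∀ vs ws → map colour vs ≡ map colour ws →
  map levelLetter (map level vs) ≡ map levelLetter (map level ws)
colours⇒letters []       []       _  = refl
colours⇒letters (v ∷ vs) (w ∷ ws) eq = let e , es = ∷-injective eq in
  cong₂ _∷_ (proj₁ (colour-injective v w e)) (colours⇒letters vs ws es)

colours⇒indices : ∀ k vs ws → map level vs ≡ map level ws → map colour vs ≡ map colour ws →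
  map ternary (indices k vs) ≡ map ternary (indices k ws)
colours⇒indices k []       []       _ _ = refl
colours⇒indices k ((l , i) ∷ vs) ((l′ , j) ∷ ws) levels eq with ∷-injective levels
... | refl , ls with l ≟ k | ∷-injective eq
... | yes _ | e , es = cong₂ _∷_ (proj₂ (colour-injective (l , i) (l , j) e)) (colours⇒indices k vs ws ls es)
... | no _  | _ , es = colours⇒indices k vs ws ls es

layered-square-free : ∀ vs ws → Layered (vs ++ ws) → map colour vs ≡ map colour ws → vs ≡ []
layered-square-free []       _        _   _  = refl
layered-square-free vs@(v ∷ vs′) ws@(_ ∷ _) lay eq with minimum (level v) (map level vs′)
... | k , k∈ , k≤vs = contradiction
  (ternary-square-free (indices k vs) (subst (Run _) (indices-++ k vs ws) (proj₂ (run-indices lay k≤)))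
    (colours⇒indices k vs ws levels eq))
  (indices-nonempty vs k∈)
  where
  levels : map level vs ≡ map level ws
  levels = walk-square _ _ _ _ (subst Walk (map-++ level vs ws) (layered⇒walk lay)) (colours⇒letters vs ws eq)
  -- The levels of the halves agree, so the minimum over the first half is one over the whole
  -- square.
  k≤ : All (λ v → k ≤ level v) (vs ++ ws)
  k≤ = ++⁺ (map⁻ k≤vs) (map⁻ (subst (All (k ≤_)) levels k≤vs))

-- Square-freeness and bifurcation of the coloured words

map-split : ∀ {A B : Set} (f : A → B) xs ys {zs} → map f xs ≡ ys ++ zs →
  ∃₂ λ xs₁ xs₂ → xs ≡ xs₁ ++ xs₂ × map f xs₁ ≡ ys × map f xs₂ ≡ zs
map-split f xs [] eq = [] , xs , refl , refl , eq
map-split f (x ∷ xs) (y ∷ ys) eq with ∷-injective eq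
... | refl , es with map-split f xs ys es
... | xs₁ , xs₂ , refl , refl , refl = x ∷ xs₁ , xs₂ , refl , refl , refl

square-free-colours : ∀ vs → Layered vs → SquareFree (map colour vs)
square-free-colours vs lay F inf (X , X≢[] , refl) with map colour vs in eq | toView inf
... | _ | MkView pre F≗ suf with refl ← Pointwise-≡⇒≡ F≗
  -- The square is lifted from colours to vertices: the prefix is split off, then the suffix, and
  -- the rest is cut in half.
  with vs₀ , vs₁ , refl , _ , eq₁ ← map-split colour vs pre eq
  with vs₂ , _ , refl , eq₂ , _ ← map-split colour vs₁ (X ++ X) eq₁
  with P , Q , refl , refl , eqQ ← map-split colour vs₂ X eq₂
  = X≢[] (cong (map colour) (layered-square-free P Q (layered-++ˡ (P ++ Q) (layered-++ʳ vs₀ lay)) (sym eqQ)))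

insertAt : ∀ n vs → Layered vs → ∃ λ v → Layered (take n vs ++ v ∷ drop n vs)
insertAt n vs lay = insert (take n vs) (drop n vs) (subst Layered (sym (take++drop≡id n vs)) lay)

colours-insert : ∀ vs (p : Position (map colour vs)) v →
  map colour (take (toℕ p) vs ++ v ∷ drop (toℕ p) vs) ≡ extend (map colour vs) p (colour v)
colours-insert vs p v = trans (map-++ colour (take (toℕ p) vs) _)
  (cong₂ (λ xs ys → xs ++ colour v ∷ ys) (sym (take-map (toℕ p) vs)) (sym (drop-map (toℕ p) vs)))

layered-bifurcate : ∀ vs → Layered vs → Bifurcate (map colour vs)
layered-bifurcate vs lay = square-free-colours vs lay , λ p →
  let v , lay′ = insertAt (toℕ p) vs lay
  in colour v , subst SquareFree (colours-insert vs p v) (square-free-colours _ lay′)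

-- The tree of insertion histories

-- Nodes are histories because different insertions may lead to the same word; the constructors keep
-- them apart. The definition is mutual since the available positions depend on the word reached,
-- and the next vertex on its layering.
data History : Set

vertices : History → List Vertex
layered  : ∀ h → Layered (vertices h)

data History where
  start : History
  at    : (h : History) → Position (map colour (vertices h)) → History

vertices start    = []
vertices (at h p) =
  take (toℕ p) (vertices h) ++
  proj₁ (insertAt (toℕ p) (vertices h) (layered h)) ∷ drop (toℕ p) (vertices h)

layered start    = []
layered (at h p) = proj₂ (insertAt (toℕ p) (vertices h) (layered h))

historyTree : RootedTree
historyTree = record
  { Node            = History
  ; root            = start
  ; Child           = λ h → Position (map colour (vertices h))
  ; child           = at
  ; child-injective = λ { _ _ refl → refl }
  ; root-not-child  = λ _ _ ()
  ; reachable       = reach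
  }
  where
  reach : ∀ h → Star (λ g h → ∃ λ p → at g p ≡ h) start h
  reach start    = ε
  reach (at h p) = reach h ◅◅ (p , refl) ◅ ε

mainTheorem5 : ∃ λ (T : BifurcateTree (Fin 12)) → Complete T
mainTheorem5 = record
  { tree               = historyTree
  ; word               = λ h → map colour (vertices h)
  ; bifurcate          = λ h → layered-bifurcate (vertices h) (layered h)
  -- Children are indexed by the positions themselves, which makes completeness immediate.
  ; position           = λ _ → id
  ; position-injective = λ _ → id
  ; child-extends      = λ h p → _ , colours-insert (vertices h) p _
  } , λ _ → id , λ p → p , id
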